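{- Let $K$ be a field of characteristic $0$ and $m\ge1$. A formal Laurent series $\sum_{\mathbf n\in\mathbb{Z}^m}b_{\mathbf n}x_1^{n_1}\cdots x_m^{n_m}$ with $b_{\mathbf n}\in K$ belongs to the field of iterated Laurent series $K\langle\!\langle x_1,\dots,x_m\rangle\!\rangle$ if and only if its support $\{\mathbf n\in\mathbb{Z}^m: b_{\mathbf n}\neq0\}$ is well-ordered with respect to the reverse lexicographic ordering on $\mathbb{Z}^m$.
   Context: $K\langle\!\langle x_1,\dots,x_m\rangle\!\rangle$ is defined inductively as $K\langle\!\langle x_1,\dots,x_{m-1}\rangle\!\rangle((x_m))$, the field of Laurent series in $x_m$ with coefficients in $K\langle\!\langle x_1,\dots,x_{m-1}\rangle\!\rangle$, starting from $K$ for $m=0$. An element of it is identified with the formal series in monomials $x_1^{n_1}\cdots x_m^{n_m}$, $\mathbf n\in\mathbb{Z}^m$, obtained by fully expanding. The reverse lexicographic ordering on $\mathbb{Z}^m$: $(n_1,\dots,n_m)<(k_1,\dots,k_m)$ iff there is an $i$ with $n_i<k_i$ and $n_j=k_j$ for all $j>i$. A totally ordered set is well-ordered if each nonempty subset has a least element. -}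

module Defs where

open import Level using (Level; _⊔_; suc; 0ℓ)
open import Algebra.Bundles using (CommutativeRing; AbelianGroup)
import Algebra.Definitions.RawMonoid as RawMonoidDefinitions
import Algebra.Properties.AbelianGroup as AbelianGroupProperties
open import Data.Nat.Base as ℕ using (ℕ)
open import Data.Integer.Base as ℤ using (ℤ)
import Data.Integer.Properties as ℤ
open import Data.Fin.Base as Fin using (Fin)
import Data.Fin.Properties as Fin
open import Data.Product.Base using (∃; ∃-syntax; _×_; _,_; proj₁; proj₂)
open import Data.Sum.Base using (_⊎_; inj₁; inj₂)
open import Data.Vec.Base using (Vec; []; _∷_; lookup; init; last)
open import Relation.Binary.Bundles using (StrictTotalOrder)
open import Relation.Binary.Core using (Rel)
open import Relation.Binary.Definitions
  using (Transitive; Trichotomous; Tri; tri<; tri≈; tri>)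
open import Relation.Binary.PropositionalEquality
  using (_≡_; refl; sym; trans; cong; subst; isEquivalence)
open import Relation.Binary.Structures.Biased using (isStrictTotalOrderᶜ)
open import Relation.Nullary.Negation using (¬_)
open import Relation.Unary using (Pred; _∈_; _⊆_; Satisfiable)

-- The library's HeytingField carries an apartness relation and admits the
-- zero ring, so the classical notion is defined here.
record Field (ℓ : Level) : Set (suc ℓ) where
  field
    commutativeRing : CommutativeRing ℓ ℓ

  open CommutativeRing commutativeRing public

  field
    1≉0     : ¬ (1# ≈ 0#)
    inverse : ∀ x → ¬ (x ≈ 0#) → ∃[ y ] (x * y ≈ 1#)

CharacteristicZero : ∀ {ℓ} → Field ℓ → Set ℓ
CharacteristicZero K = ∀ n → n ×ₙ 1# ≈ 0# → n ≡ 0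
  where
  open Field K
  open RawMonoidDefinitions +-rawMonoid renaming (_×_ to _×ₙ_)

-- A((x)): families of coefficients indexed by ℤ that vanish below some
-- exponent. Only the additive structure of A enters.
record LaurentSeries {a ℓ} (A : AbelianGroup a ℓ) : Set (a ⊔ ℓ) where
  open AbelianGroup A
  field
    coeff        : ℤ → Carrier
    boundedBelow : ∃[ N ] (∀ n → n ℤ.< N → coeff n ≈ ε)

open LaurentSeries public

laurentSeriesGroup : ∀ {a ℓ} → AbelianGroup a ℓ → AbelianGroup (a ⊔ ℓ) ℓ
laurentSeriesGroup A = record
  { Carrier = LaurentSeries A
  ; _≈_     = λ f g → ∀ n → coeff f n A.≈ coeff g n
  ; _∙_     = λ f g → record
    { coeff        = λ n → coeff f n A.∙ coeff g n
    ; boundedBelow = boundedBelow-∙ (boundedBelow f) (boundedBelow g)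
    }
  ; ε       = record
    { coeff        = λ _ → A.ε
    ; boundedBelow = ℤ.0ℤ , λ _ _ → A.refl
    }
  ; _⁻¹     = λ f → record
    { coeff        = λ n → coeff f n A.⁻¹
    ; boundedBelow = proj₁ (boundedBelow f) , λ n n<N →
        A.trans (A.⁻¹-cong (proj₂ (boundedBelow f) n n<N)) ε⁻¹≈ε
    }
  ; isAbelianGroup = record
    { isGroup = record
      { isMonoid = record
        { isSemigroup = record
          { isMagma = record
            { isEquivalence = record
              { refl  = λ _ → A.refl
              ; sym   = λ p n → A.sym (p n)
              ; trans = λ p q n → A.trans (p n) (q n)
              }
            ; ∙-cong = λ p q n → A.∙-cong (p n) (q n)
            }
          ; assoc = λ f g h n → A.assoc (coeff f n) (coeff g n) (coeff h n)
          }
        ; identity = (λ f n → A.identityˡ (coeff f n))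
                   , (λ f n → A.identityʳ (coeff f n))
        }
      ; inverse = (λ f n → A.inverseˡ (coeff f n))
                , (λ f n → A.inverseʳ (coeff f n))
      ; ⁻¹-cong = λ p n → A.⁻¹-cong (p n)
      }
    ; comm = λ f g n → A.comm (coeff f n) (coeff g n)
    }
  }
  where
  module A = AbelianGroup A
  open AbelianGroupProperties A using (ε⁻¹≈ε)

  boundedBelow-∙ : {u v : ℤ → A.Carrier} →
    ∃[ N ] (∀ n → n ℤ.< N → u n A.≈ A.ε) →
    ∃[ N ] (∀ n → n ℤ.< N → v n A.≈ A.ε) →
    ∃[ N ] (∀ n → n ℤ.< N → (u n A.∙ v n) A.≈ A.ε)
  boundedBelow-∙ (M , p) (N , q) = M ℤ.⊓ N , λ n n<M⊓N → A.trans
    (A.∙-cong (p n (ℤ.<-≤-trans n<M⊓N (ℤ.i⊓j≤i M N)))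
              (q n (ℤ.<-≤-trans n<M⊓N (ℤ.i⊓j≤j M N))))
    (A.identityˡ A.ε)

module _ {ℓ} (K : Field ℓ) where

  private module K = Field K

  -- The additive group of K⟨⟨x₁,…,xₘ⟩⟩ = K⟨⟨x₁,…,xₘ₋₁⟩⟩((xₘ)).
  iteratedLaurentGroup : ℕ → AbelianGroup ℓ ℓ
  iteratedLaurentGroup ℕ.zero    = K.+-abelianGroup
  iteratedLaurentGroup (ℕ.suc m) = laurentSeriesGroup (iteratedLaurentGroup m)

  IteratedLaurentSeries : ℕ → Set ℓ
  IteratedLaurentSeries m = AbelianGroup.Carrier (iteratedLaurentGroup m)

  -- Σ bₙ x₁^n₁ ⋯ xₘ^nₘ; the exponents are listed in the order n₁, …, nₘ.
  FormalLaurentSeries : ℕ → Set ℓ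
  FormalLaurentSeries m = Vec ℤ m → K.Carrier

  -- xₘ is the outermost variable, and its exponent is the last entry.
  expand : ∀ m → IteratedLaurentSeries m → FormalLaurentSeries m
  expand ℕ.zero    a _ = a
  expand (ℕ.suc m) f n = expand m (coeff f (last n)) (init n)

  BelongsToIterated : ∀ {m} → FormalLaurentSeries m → Set ℓ
  BelongsToIterated {m} b =
    ∃[ f ] (∀ n → expand m f n K.≈ b n)

  support : ∀ {m} → FormalLaurentSeries m → Pred (Vec ℤ m) ℓ
  support b n = ¬ (b n K.≈ K.0#)

infix 4 _<ᵣ_

_<ᵣ_ : ∀ {m} → Rel (Vec ℤ m) 0ℓ
n <ᵣ k = ∃[ i ] (lookup n i ℤ.< lookup k i
                × (∀ j → i Fin.< j → lookup n j ≡ lookup k j))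

<ᵣ-trans : ∀ {m} → Transitive (_<ᵣ_ {m})
<ᵣ-trans {i = n} {j = k} {k = l} (i , n<k , n≡k) (j , k<l , k≡l)
  with Fin.<-cmp i j
... | tri< i<j _ _ =
  j , subst (ℤ._< lookup l j) (sym (n≡k j i<j)) k<l
    , λ h j<h → trans (n≡k h (Fin.<-trans i<j j<h)) (k≡l h j<h)
... | tri≈ _ refl _ =
  i , ℤ.<-trans n<k k<l , λ h i<h → trans (n≡k h i<h) (k≡l h i<h)
... | tri> _ _ j<i =
  i , subst (lookup n i ℤ.<_) (k≡l i j<i) n<k
    , λ h i<h → trans (n≡k h i<h) (k≡l h (Fin.<-trans j<i i<h))

<ᵣ-irrefl : ∀ {m} (n : Vec ℤ m) → ¬ (n <ᵣ n)
<ᵣ-irrefl n (_ , n<n , _) = ℤ.<-irrefl refl n<n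

<ᵣ-asym : ∀ {m} (n k : Vec ℤ m) → n <ᵣ k → ¬ (k <ᵣ n)
<ᵣ-asym n k n<k k<n = <ᵣ-irrefl n (<ᵣ-trans {i = n} {j = k} {k = n} n<k k<n)

<ᵣ-cmp : ∀ {m} → Trichotomous _≡_ (_<ᵣ_ {m})
<ᵣ-cmp n k = fromCases n k (cases n k)
  where
  cases : ∀ {m} (n k : Vec ℤ m) → n <ᵣ k ⊎ n ≡ k ⊎ k <ᵣ n
  cases []      []      = inj₂ (inj₁ refl)
  cases (x ∷ n) (y ∷ k) with cases n k
  ... | inj₁ (i , p , q) =
    inj₁ (Fin.suc i , p , λ { (Fin.suc j) (ℕ.s≤s i<j) → q j i<j })
  ... | inj₂ (inj₂ (i , p , q)) =
    inj₂ (inj₂ (Fin.suc i , p , λ { (Fin.suc j) (ℕ.s≤s i<j) → q j i<j }))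
  ... | inj₂ (inj₁ refl) with ℤ.<-cmp x y
  ...   | tri< x<y _ _ = inj₁ (Fin.zero , x<y , λ { (Fin.suc j) _ → refl })
  ...   | tri≈ _ x≡y _ = inj₂ (inj₁ (cong (_∷ n) x≡y))
  ...   | tri> _ _ y<x =
    inj₂ (inj₂ (Fin.zero , y<x , λ { (Fin.suc j) _ → refl }))

  fromCases : ∀ {m} (n k : Vec ℤ m) →
    n <ᵣ k ⊎ n ≡ k ⊎ k <ᵣ n → Tri (n <ᵣ k) (n ≡ k) (k <ᵣ n)
  fromCases n k (inj₁ n<k) =
    tri< n<k (λ { refl → <ᵣ-irrefl n n<k }) (<ᵣ-asym n k n<k)
  fromCases n _ (inj₂ (inj₁ refl)) = tri≈ (<ᵣ-irrefl n) refl (<ᵣ-irrefl n)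
  fromCases n k (inj₂ (inj₂ k<n)) =
    tri> (<ᵣ-asym k n k<n) (λ { refl → <ᵣ-irrefl n k<n }) k<n

reverseLex : ℕ → StrictTotalOrder 0ℓ 0ℓ 0ℓ
reverseLex m = record
  { Carrier            = Vec ℤ m
  ; _≈_                = _≡_
  ; _<_                = _<ᵣ_
  ; isStrictTotalOrder = isStrictTotalOrderᶜ record
    { isEquivalence = isEquivalence
    ; trans         = λ {i} {j} {k} → <ᵣ-trans {i = i} {j} {k}
    ; compare       = <ᵣ-cmp
    }
  }

module _ {a ℓ₁ ℓ₂} (O : StrictTotalOrder a ℓ₁ ℓ₂) where

  open StrictTotalOrder O

  IsLeast : ∀ {ℓ} → Pred Carrier ℓ → Carrier → Set (a ⊔ ℓ₁ ⊔ ℓ₂ ⊔ ℓ)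
  IsLeast T x = x ∈ T × (∀ y → y ∈ T → x < y ⊎ x ≈ y)

  -- Well-orderedness of a subset S with the induced order. The subsets T are
  -- taken at the universe level of S; under excluded middle this is harmless,
  -- since then every subset is equivalent to a Boolean-valued one.
  WellOrdered : ∀ {ℓ} → Pred Carrier ℓ → Set (a ⊔ ℓ₁ ⊔ ℓ₂ ⊔ suc ℓ)
  WellOrdered {ℓ} S =
    ∀ (T : Pred Carrier ℓ) → T ⊆ S → Satisfiable T → ∃[ x ] IsLeast T x

{-# OPTIONS --safe #-}

-- A subset of ℤᵐ⁺¹ is well-ordered for the reverse lexicographic order exactly
-- when its last exponents are bounded below and all its slices at a fixed last
-- exponent are well-ordered. The membership of a series in
-- K⟨⟨x₁,…,xₘ⟩⟩((xₘ₊₁)) decomposes in the same way along its last variable, so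
-- the two conditions agree by induction on m.
module Submission where

open import Defs
open import Algebra.Bundles using (AbelianGroup)
open import Axiom.DoubleNegationElimination using (em⇒dne)
open import Axiom.ExcludedMiddle using (ExcludedMiddle)
open import Data.Fin.Base as Fin using (Fin; fromℕ; inject₁)
import Data.Fin.Properties as Fin
open import Data.Fin.Relation.Unary.Top using (view; ‵fromℕ; ‵inject₁)
open import Data.Integer.Base as ℤ using (ℤ; 0ℤ; ∣_∣; _-_)
import Data.Integer.Properties as ℤ
open import Data.Nat.Base as ℕ using (ℕ; _≤_)
open import Data.Nat.Induction using (<-wellFounded)
import Data.Nat.Properties as ℕ
open import Data.Product.Base using (∃-syntax; _×_; _,_; proj₁; proj₂)
open import Data.Sum.Base using (_⊎_; inj₁; inj₂)
open import Data.Vec.Base using (Vec; []; _∷_; _∷ʳ_; lookup; init; last; initLast)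
open import Data.Vec.Properties using (init-∷ʳ; last-∷ʳ)
open import Function.Base using (_∘_)
open import Function.Bundles using (_⇔_; mk⇔)
open import Induction.WellFounded using (Acc; acc)
open import Level using (Level)
open import Relation.Binary.Definitions using (tri<; tri≈; tri>)
open import Relation.Binary.PropositionalEquality
  using (_≡_; refl; sym; trans; cong; cong₂; subst; subst₂)
open import Relation.Nullary.Decidable.Core using (yes; no)
open import Relation.Nullary.Negation using (¬_; contradiction)
open import Relation.Unary using (Pred; _∈_)

private
  variable
    ℓ : Level
    m : ℕ

-- Reverse lexicographic order through `last` and `init`.

∷ʳ-η : (n : Vec ℤ (ℕ.suc m)) → n ≡ init n ∷ʳ last n
∷ʳ-η n = proj₂ (proj₂ (initLast n))

lookup-inject₁ : (n : Vec ℤ (ℕ.suc m)) (i : Fin m) →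
  lookup n (inject₁ i) ≡ lookup (init n) i
lookup-inject₁ (x ∷ n) Fin.zero    = refl
lookup-inject₁ (x ∷ n) (Fin.suc i) = lookup-inject₁ n i

lookup-fromℕ : (n : Vec ℤ (ℕ.suc m)) → lookup n (fromℕ m) ≡ last n
lookup-fromℕ (x ∷ [])    = refl
lookup-fromℕ (x ∷ y ∷ n) = lookup-fromℕ (y ∷ n)

inject₁-cancel-< : {i j : Fin m} → inject₁ i Fin.< inject₁ j → i Fin.< j
inject₁-cancel-< {i = i} {j} =
  subst₂ ℕ._<_ (Fin.toℕ-inject₁ i) (Fin.toℕ-inject₁ j)

last<⇒<ᵣ : (n k : Vec ℤ (ℕ.suc m)) → last n ℤ.< last k → n <ᵣ k
last<⇒<ᵣ n k n<k =
  fromℕ _ , subst₂ ℤ._<_ (sym (lookup-fromℕ n)) (sym (lookup-fromℕ k)) n<k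
          , λ j m<j → contradiction m<j (ℕ.≤⇒≯ (Fin.≤fromℕ j))

init<⇒<ᵣ : (n k : Vec ℤ (ℕ.suc m)) →
  last n ≡ last k → init n <ᵣ init k → n <ᵣ k
init<⇒<ᵣ n k last≡ (i , n<k , n≡k) =
  inject₁ i
  , subst₂ ℤ._<_ (sym (lookup-inject₁ n i)) (sym (lookup-inject₁ k i)) n<k
  , above
  where
  above : ∀ j → inject₁ i Fin.< j → lookup n j ≡ lookup k j
  -- An index above `inject₁ i` is either the top one, where `last≡` applies, or an embedded one,
  -- where the agreement of the initial segments above `i` applies.
  above j i<j with view j
  ... | ‵fromℕ = trans (lookup-fromℕ n) (trans last≡ (sym (lookup-fromℕ k)))
  ... | ‵inject₁ j′ =
    trans (lookup-inject₁ n j′)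
          (trans (n≡k j′ (inject₁-cancel-< i<j)) (sym (lookup-inject₁ k j′)))

infix 4 _≤ᵣ_

_≤ᵣ_ : Vec ℤ m → Vec ℤ m → Set
n ≤ᵣ k = n <ᵣ k ⊎ n ≡ k

≤ᵣ⇒≯ᵣ : {n k : Vec ℤ m} → n ≤ᵣ k → ¬ (k <ᵣ n)
≤ᵣ⇒≯ᵣ {n = n} {k} (inj₁ n<k)  = <ᵣ-asym n k n<k
≤ᵣ⇒≯ᵣ {n = n}     (inj₂ refl) = <ᵣ-irrefl n

-- With `≤ᵣ⇒≯ᵣ`, this makes `≤ᵣ` the negation of the reversed `<ᵣ`, so that the next two lemmas are
-- contrapositives of `last<⇒<ᵣ` and `init<⇒<ᵣ`.
≯ᵣ⇒≤ᵣ : {n k : Vec ℤ m} → ¬ (k <ᵣ n) → n ≤ᵣ k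
≯ᵣ⇒≤ᵣ {n = n} {k} k≮n with <ᵣ-cmp n k
... | tri< n<k _ _ = inj₁ n<k
... | tri≈ _ n≡k _ = inj₂ n≡k
... | tri> _ _ k<n = contradiction k<n k≮n

≤ᵣ⇒last≤ : {n k : Vec ℤ (ℕ.suc m)} → n ≤ᵣ k → last n ℤ.≤ last k
≤ᵣ⇒last≤ {n = n} {k} n≤k = ℤ.≮⇒≥ (≤ᵣ⇒≯ᵣ n≤k ∘ last<⇒<ᵣ k n)

≤ᵣ⇒init≤ᵣ : {n k : Vec ℤ (ℕ.suc m)} →
  last n ≡ last k → n ≤ᵣ k → init n ≤ᵣ init k
≤ᵣ⇒init≤ᵣ {n = n} {k} last≡ n≤k =
  ≯ᵣ⇒≤ᵣ (≤ᵣ⇒≯ᵣ n≤k ∘ init<⇒<ᵣ k n (sym last≡))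

init≤ᵣ⇒≤ᵣ : (n k : Vec ℤ (ℕ.suc m)) →
  last n ≡ last k → init n ≤ᵣ init k → n ≤ᵣ k
init≤ᵣ⇒≤ᵣ n k last≡ (inj₁ init<) = inj₁ (init<⇒<ᵣ n k last≡ init<)
init≤ᵣ⇒≤ᵣ n k last≡ (inj₂ init≡) =
  inj₂ (trans (∷ʳ-η n) (trans (cong₂ _∷ʳ_ init≡ last≡) (sym (∷ʳ-η k))))

-- Descent on the distance to `N`: excluded middle decides whether a smaller element of `P` exists,
-- and each such element is strictly closer to `N`.
leastInteger : ExcludedMiddle ℓ → (P : Pred ℤ ℓ) (N : ℤ) →
  (∀ i → i ∈ P → N ℤ.≤ i) → ∀ i → i ∈ P →
  ∃[ j ] (j ∈ P × (∀ k → k ∈ P → j ℤ.≤ k))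
leastInteger em P N N≤P i i∈P = descend i i∈P (<-wellFounded ∣ i - N ∣)
  where
  distance-mono : ∀ {j k} → j ∈ P → k ∈ P → k ℤ.< j →
    ∣ k - N ∣ ℕ.< ∣ j - N ∣
  -- Both differences are nonnegative because `N` bounds `P` from below, so they equal their
  -- absolute values.
  distance-mono {j} {k} j∈P k∈P k<j = ℤ.drop‿+<+
    (subst₂ ℤ._<_ (sym (ℤ.0≤i⇒+∣i∣≡i (ℤ.i≤j⇒0≤j-i (N≤P k k∈P))))
                  (sym (ℤ.0≤i⇒+∣i∣≡i (ℤ.i≤j⇒0≤j-i (N≤P j j∈P))))
                  (ℤ.+-monoˡ-< (ℤ.- N) k<j))

  descend : ∀ j → j ∈ P → Acc ℕ._<_ ∣ j - N ∣ →
    ∃[ l ] (l ∈ P × (∀ k → k ∈ P → l ℤ.≤ k))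
  descend j j∈P (acc rs) with em {∃[ k ] (k ∈ P × k ℤ.< j)}
  ... | yes (k , k∈P , k<j) =
    descend k k∈P (rs (distance-mono j∈P k∈P k<j))
  ... | no ∄k = j , j∈P , λ k k∈P → ℤ.≮⇒≥ λ k<j → ∄k (k , k∈P , k<j)

-- Well-ordered subsets and their slices.

LastBoundedBelow : Pred (Vec ℤ (ℕ.suc m)) ℓ → Set ℓ
LastBoundedBelow S = ∃[ N ] (∀ n → n ∈ S → N ℤ.≤ last n)

-- Generic in `A` to cover both subsets and coefficient families; `slice (support K b) k` and
-- `support K (slice b k)` then agree by definition, which the final inductions rely on.
slice : ∀ {a} {A : Set a} → (Vec ℤ (ℕ.suc m) → A) → ℤ → Vec ℤ m → A
slice S k v = S (v ∷ʳ k)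

module _ (em : ExcludedMiddle ℓ) (S : Pred (Vec ℤ (ℕ.suc m)) ℓ) where

  wellOrdered⇒lastBoundedBelow :
    WellOrdered (reverseLex (ℕ.suc m)) S → LastBoundedBelow S
  wellOrdered⇒lastBoundedBelow wo with em {∃[ n ] (n ∈ S)}
  -- Any integer bounds the empty set; otherwise the least element of `S` itself supplies the bound.
  ... | no S-empty = 0ℤ , λ n n∈S → contradiction (n , n∈S) S-empty
  ... | yes inhabited with wo S (λ n∈S → n∈S) inhabited
  ...   | x , _ , x≤S = last x , λ n n∈S → ≤ᵣ⇒last≤ (x≤S n n∈S)

  wellOrdered⇒slice : WellOrdered (reverseLex (ℕ.suc m)) S →
    ∀ k → WellOrdered (reverseLex m) (slice S k)
  wellOrdered⇒slice wo k T T⊆ (v , v∈T) =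
    let x , (last-x≡k , init-x∈T) , x≤ = wo T∷ʳk T∷ʳk⊆S (v ∷ʳ k , ∷ʳ∈T v v∈T)
    in  init x , init-x∈T , λ y y∈T →
          subst (init x ≤ᵣ_) (init-∷ʳ k y)
            (≤ᵣ⇒init≤ᵣ (trans last-x≡k (sym (last-∷ʳ k y)))
                       (x≤ (y ∷ʳ k) (∷ʳ∈T y y∈T)))
    where
    T∷ʳk : Pred (Vec ℤ (ℕ.suc m)) ℓ
    -- This is `T` placed at last exponent `k`. Phrasing it through `last` and `init` lets its least
    -- element be truncated directly to one of `T`.
    T∷ʳk n = last n ≡ k × T (init n)

    T∷ʳk⊆S : ∀ {n} → n ∈ T∷ʳk → n ∈ S
    T∷ʳk⊆S {n} (refl , init-n∈T) = subst S (sym (∷ʳ-η n)) (T⊆ init-n∈T)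

    ∷ʳ∈T : ∀ v → v ∈ T → (v ∷ʳ k) ∈ T∷ʳk
    ∷ʳ∈T v v∈T = last-∷ʳ k v , subst T (sym (init-∷ʳ k v)) v∈T

  -- The least element is found in two stages: first the least last exponent `l` occurring in `T`,
  -- then the least initial segment `v` in the slice of `T` at `l`.
  slices⇒wellOrdered : LastBoundedBelow S →
    (∀ k → WellOrdered (reverseLex m) (slice S k)) →
    WellOrdered (reverseLex (ℕ.suc m)) S
  slices⇒wellOrdered (N , N≤) wo T T⊆S (t , t∈T) =
    v ∷ʳ l , v∷ʳl∈T , least
    where
    lasts : Pred ℤ ℓ
    lasts i = ∃[ u ] (u ∷ʳ i ∈ T)

    last∈lasts : ∀ n → n ∈ T → last n ∈ lasts
    last∈lasts n n∈T = init n , subst T (∷ʳ-η n) n∈T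

    least-last : ∃[ i ] (i ∈ lasts × (∀ k → k ∈ lasts → i ℤ.≤ k))
    least-last = leastInteger em lasts N
      (λ { i (u , u∷ʳi∈T) → subst (N ℤ.≤_) (last-∷ʳ i u) (N≤ _ (T⊆S u∷ʳi∈T)) })
      (last t) (last∈lasts t t∈T)

    l   = proj₁ least-last
    l∈  = proj₁ (proj₂ least-last)
    l≤  = proj₂ (proj₂ least-last)

    least-init = wo l (slice T l) T⊆S l∈

    v       = proj₁ least-init
    v∷ʳl∈T  = proj₁ (proj₂ least-init)
    v≤      = proj₂ (proj₂ least-init)

    least : ∀ n → n ∈ T → v ∷ʳ l ≤ᵣ n
    least n n∈T with ℤ.<-cmp l (last n)
    ... | tri< l<n _ _ =
      inj₁ (last<⇒<ᵣ _ n (subst (ℤ._< last n) (sym (last-∷ʳ l v)) l<n))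
    ... | tri≈ _ l≡n _ =
      init≤ᵣ⇒≤ᵣ _ n (trans (last-∷ʳ l v) l≡n)
        (subst (_≤ᵣ init n) (sym (init-∷ʳ l v))
          (v≤ (init n)
            (subst (λ i → T (init n ∷ʳ i)) (sym l≡n) (subst T (∷ʳ-η n) n∈T))))
    ... | tri> _ _ n<l =
      contradiction n<l (ℤ.≤⇒≯ (l≤ (last n) (last∈lasts n n∈T)))

-- Iterated Laurent series along the last variable.

module _ (K : Field ℓ) where

  private
    module K = Field K
    module G m = AbelianGroup (iteratedLaurentGroup K m)

  expand-≈0 : ∀ m {f} → G._≈_ m f (G.ε m) → ∀ n → expand K m f n K.≈ K.0#
  expand-≈0 ℕ.zero    f≈ε n = f≈ε
  expand-≈0 (ℕ.suc m) f≈ε n = expand-≈0 m (f≈ε (last n)) (init n)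

  -- Not definitional, since `last` and `init` do not reduce on `v ∷ʳ k` for a variable `v`.
  expand-∷ʳ : ∀ m f v k →
    expand K (ℕ.suc m) f (v ∷ʳ k) ≡ expand K m (coeff f k) v
  expand-∷ʳ m f v k =
    cong₂ (λ k v → expand K m (coeff f k) v) (last-∷ʳ k v) (init-∷ʳ k v)

  -- Equality of Laurent series is coefficientwise at every level. This turns vanishing scalars into
  -- the vanishing coefficient series that `boundedBelow` asks for.
  expand-injective-0 : ∀ m {f} →
    (∀ n → expand K m f n K.≈ K.0#) → G._≈_ m f (G.ε m)
  expand-injective-0 ℕ.zero    f≈0   = f≈0 []
  expand-injective-0 (ℕ.suc m) {f} f≈0 k = expand-injective-0 m λ v →
    K.trans (K.reflexive (sym (expand-∷ʳ m f v k))) (f≈0 (v ∷ʳ k))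

  belongs⇒lastBoundedBelow : (b : FormalLaurentSeries K (ℕ.suc m)) →
    BelongsToIterated K b → LastBoundedBelow (support K b)
  belongs⇒lastBoundedBelow {m = m} b (f , f≈b) =
    let N , f≈ε = boundedBelow f
    in  N , λ n n∈S → ℤ.≮⇒≥ λ n<N →
          n∈S (K.trans (K.sym (f≈b n)) (expand-≈0 m (f≈ε (last n) n<N) (init n)))

  belongs⇒slice : (b : FormalLaurentSeries K (ℕ.suc m)) →
    BelongsToIterated K b → ∀ k → BelongsToIterated K (slice b k)
  belongs⇒slice {m = m} b (f , f≈b) k = coeff f k , λ v →
    K.trans (K.reflexive (sym (expand-∷ʳ m f v k))) (f≈b (v ∷ʳ k))

  -- The series representing the slice at `k` becomes the coefficient of the `k`-th power of the
  -- last variable.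
  slices⇒belongs : ExcludedMiddle ℓ → (b : FormalLaurentSeries K (ℕ.suc m)) →
    LastBoundedBelow (support K b) →
    (∀ k → BelongsToIterated K (slice b k)) → BelongsToIterated K b
  slices⇒belongs {m = m} em b (N , N≤) belongs = f , λ n →
    K.trans (proj₂ (belongs (last n)) (init n))
            (K.reflexive (cong b (sym (∷ʳ-η n))))
    where
    vanishes : ∀ k → k ℤ.< N → ∀ v → b (v ∷ʳ k) K.≈ K.0#
    -- Lying outside the support only says that a coefficient is not nonzero; excluded middle makes
    -- it zero.
    vanishes k k<N v = em⇒dne em λ b≉0 →
      ℤ.<⇒≱ k<N (subst (N ℤ.≤_) (last-∷ʳ k v) (N≤ (v ∷ʳ k) b≉0))

    f : IteratedLaurentSeries K (ℕ.suc m)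
    f = record
      { coeff        = λ k → proj₁ (belongs k)
      ; boundedBelow = N , λ k k<N → expand-injective-0 m λ v →
          K.trans (proj₂ (belongs k) v) (vanishes k k<N v)
      }

  module _ (em : ExcludedMiddle ℓ) where

    belongs⇒wellOrdered : ∀ m (b : FormalLaurentSeries K m) →
      BelongsToIterated K b → WellOrdered (reverseLex m) (support K b)
    -- The only exponent vector of length zero is `[]`.
    belongs⇒wellOrdered ℕ.zero b _ T _ ([] , []∈T) =
      [] , []∈T , λ { [] _ → inj₂ refl }
    belongs⇒wellOrdered (ℕ.suc m) b belongs =
      slices⇒wellOrdered em (support K b) (belongs⇒lastBoundedBelow b belongs)
        λ k → belongs⇒wellOrdered m (slice b k) (belongs⇒slice b belongs k)

    wellOrdered⇒belongs : ∀ m (b : FormalLaurentSeries K m) →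
      WellOrdered (reverseLex m) (support K b) → BelongsToIterated K b
    wellOrdered⇒belongs ℕ.zero    b _  = b [] , λ { [] → K.refl }
    wellOrdered⇒belongs (ℕ.suc m) b wo =
      slices⇒belongs em b (wellOrdered⇒lastBoundedBelow em (support K b) wo)
        λ k → wellOrdered⇒belongs m (slice b k)
                (wellOrdered⇒slice em (support K b) wo k)

mainTheorem4 : ∀ {ℓ} → ExcludedMiddle ℓ →
    (K : Field ℓ) → CharacteristicZero K →
    (m : ℕ) → 1 ≤ m →
    (b : FormalLaurentSeries K m) →
    BelongsToIterated K b ⇔ WellOrdered (reverseLex m) (support K b)
mainTheorem4 em K _ m _ b =
  mk⇔ (belongs⇒wellOrdered K em m b) (wellOrdered⇒belongs K em m b)
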